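{- Let $r\ge 1$ be an integer and let $T$ be a (finite) tree with $|V(T)|\ge r+1$. A vertex $v\in V(T)$ is a shedding vertex of $\mathrm{Ind}_r(T)$ if and only if, when $T$ is viewed as rooted at $v$, there exists a subset $A\subseteq \mathrm{Ch}(v)$ such that $|V(T_u)|\le r$ for every $u\in A$ and $$\Big|\Big(\bigsqcup_{u\in A}V(T_u)\Big)\cup\{v\}\Big|\ge r+1 .$$
   Context: Graphs are finite and simple. For a graph $G$ and $A\subseteq V(G)$, $G[A]$ denotes the induced subgraph on $A$. A tree is a connected graph in which there is a unique path between every pair of distinct vertices. For a tree $T$ rooted at $v$: the parent of a vertex $u\ne v$ is the neighbour of $u$ on the unique path from $u$ to $v$, and $u$ is then a child of its parent; $\mathrm{Ch}(u)$ is the set of children of $u$. A vertex $w$ is a descendant of $u$ if $u$ lies on the unique path from the root $v$ to $w$. The rooted subtree $T_u$ is the subtree of $T$ induced by $u$ together with all descendants of $u$, rooted at $u$. For an integer $r\ge 1$, a subset $A\subseteq V(G)$ is $r$-independent if every connected component of $G[A]$ has at most $r$ vertices. The $r$-independence complex $\mathrm{Ind}_r(G)$ is the simplicial complex whose faces are all $r$-independent subsets of $V(G)$. Facets of a simplicial complex are its inclusion-maximal faces. For a vertex $v$ of a simplicial complex $\Delta$, $\mathrm{del}_\Delta(v)=\{F\in\Delta: v\notin F\}$. The vertex $v$ is a shedding vertex of $\Delta$ if every facet of $\mathrm{del}_\Delta(v)$ is a facet of $\Delta$; equivalently, for every facet $F$ of $\mathrm{del}_\Delta(v)$, $F\cup\{v\}$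 is not a face of $\Delta$. -}

module Defs where

open import Data.Fin using (Fin; _≟_)
open import Data.Fin.Properties using (sequence)
open import Data.Fin.Subset using (Subset; _∈_; _∉_; _⊆_; _∪_; ⋃; ⁅_⁆; ∣_∣)
open import Data.Fin.Subset.Properties using (_∈?_; p⊆q⇒∣p∣≤∣q∣)
open import Data.List using (List; []; _∷_; allFin; filter; head; last; map)
import Data.List.Membership.DecPropositional as DecMembership
import Data.List.Membership.Propositional as Membership
open import Data.List.Relation.Unary.Linked using (Linked)
open import Data.List.Relation.Unary.Unique.Propositional using (Unique)
open import Data.Maybe using (just)
open import Data.Nat using (ℕ; _≤_; _≤?_)
open import Data.Nat.Properties using (≤-trans)
open import Data.Product using (∃; ∃!; _×_; _,_; proj₁)
open import Data.Vec using (tabulate)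
open import Data.Vec.Properties using (lookup∘tabulate; lookup⇒[]=; []=⇒lookup)
open import Effect.Monad using (RawMonad)
open import Function using (_∘_; _⇔_; mk⇔; Equivalence)
open import Level using (0ℓ)
open import Relation.Binary using (Rel; Decidable; Symmetric; Irreflexive)
open import Relation.Binary.Construct.Closure.ReflexiveTransitive using (Star)
import Relation.Binary.Construct.Closure.ReflexiveTransitive as Star
open import Relation.Binary.PropositionalEquality using (_≡_; _≢_; refl; sym; trans)
open import Relation.Nullary using (Dec; does; yes; no; ¬?; _×-dec_)
open import Relation.Nullary.Decidable using (decidable-stable; dec-true; ¬¬-excluded-middle)
open import Relation.Nullary.Negation using (¬¬-Monad)
import Relation.Unary as U

private
  variable
    n : ℕ

------------------------------------------------------------------------
-- Subsets of Fin n

fromDec : {P : U.Pred (Fin n) 0ℓ} → U.Decidable P → Subset n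
fromDec P? = tabulate (λ x → does (P? x))

∈-fromDec : {P : U.Pred (Fin n) 0ℓ} (P? : U.Decidable P) {x : Fin n} →
            x ∈ fromDec P? ⇔ P x
∈-fromDec {P = P} P? {x} = mk⇔ to from
  where
  to : x ∈ fromDec P? → P x
  to x∈ with P? x | trans (sym (lookup∘tabulate (λ y → does (P? y)) x)) ([]=⇒lookup x∈)
  ... | yes p | _  = p
  ... | no _  | ()

  from : P x → x ∈ fromDec P?
  from p = lookup⇒[]= x _
    (trans (lookup∘tabulate (λ y → does (P? y)) x) (dec-true (P? x) p))

⋃[_] : Subset n → (Fin n → Subset n) → Subset n
⋃[ A ] S = ⋃ (map S (filter (_∈? A) (allFin _)))

------------------------------------------------------------------------
-- Finite simple graphs with vertex set Fin n

record Graph (n : ℕ) : Set₁ where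
  field
    Adj    : Rel (Fin n) 0ℓ
    adj?   : Decidable Adj
    symm   : Symmetric Adj
    irrefl : Irreflexive _≡_ Adj

open Graph public

-- A path is given by the list of its vertices.
record IsPath (G : Graph n) (u w : Fin n) (xs : List (Fin n)) : Set where
  field
    starts   : head xs ≡ just u
    ends     : last xs ≡ just w
    linked   : Linked (Adj G) xs
    distinct : Unique xs

record IsTree (G : Graph n) : Set where
  field
    connected  : ∀ u w → Star (Adj G) u w
    uniquePath : ∀ u w → u ≢ w → ∃! _≡_ (IsPath G u w)

-- Adjacency in the induced subgraph G[A].
AdjIn : Graph n → Subset n → Rel (Fin n) 0ℓ
AdjIn G A x y = x ∈ A × y ∈ A × Adj G x y

-- C is the vertex set of a connected component of G[A]: the class of
-- some x ∈ A under reachability inside G[A].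
IsComponent : Graph n → Subset n → Subset n → Set
IsComponent G A C = ∃ λ x → x ∈ A × (∀ y → y ∈ C ⇔ Star (AdjIn G A) x y)

IsIndependent : ℕ → Graph n → Subset n → Set
IsIndependent r G A = ∀ C → IsComponent G A C → ∣ C ∣ ≤ r

------------------------------------------------------------------------
-- Simplicial complexes

record SimplicialComplex (n : ℕ) : Set₁ where
  field
    Face       : U.Pred (Subset n) 0ℓ
    downClosed : ∀ {F F′} → F′ ⊆ F → Face F → Face F′

open SimplicialComplex public

IsFacet : SimplicialComplex n → Subset n → Set
IsFacet Δ F = Face Δ F × (∀ F′ → Face Δ F′ → F ⊆ F′ → F ≡ F′)

del : SimplicialComplex n → Fin n → SimplicialComplex n
del Δ v .Face F = Face Δ F × v ∉ F
del Δ v .downClosed F′⊆F (face , v∉F) = downClosed Δ F′⊆F face , v∉F ∘ F′⊆F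

record IsSheddingVertex (Δ : SimplicialComplex n) (v : Fin n) : Set where
  field
    vertex : Face Δ ⁅ v ⁆
    shed   : ∀ F → IsFacet (del Δ v) F → IsFacet Δ F

-- The component of x in G[A] is needed as a Subset; since the goal ∣ C ∣ ≤ r
-- is decidable, reachability from x may be assumed decidable.
independent-⊆ : ∀ r (G : Graph n) {A B} → B ⊆ A →
                IsIndependent r G A → IsIndependent r G B
independent-⊆ r G {A} {B} B⊆A indep C (x , x∈B , C⇔) =
  decidable-stable (∣ C ∣ ≤? r) λ ¬le →
    sequence (RawMonad.rawApplicative ¬¬-Monad)
             {P = λ y → Dec (Star (AdjIn G A) x y)}
             (λ _ → ¬¬-excluded-middle)
             (¬le ∘ bound)
  where
  enlarge : ∀ {y z} → AdjIn G B y z → AdjIn G A y z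
  enlarge (y∈B , z∈B , yz) = B⊆A y∈B , B⊆A z∈B , yz

  bound : U.Decidable (Star (AdjIn G A) x) → ∣ C ∣ ≤ r
  bound reach? = ≤-trans
    (p⊆q⇒∣p∣≤∣q∣ λ {y} y∈C →
      Equivalence.from (∈-fromDec reach?)
        (Star.map enlarge (Equivalence.to (C⇔ y) y∈C)))
    (indep (fromDec reach?) (x , B⊆A x∈B , λ _ → ∈-fromDec reach?))

Ind : ℕ → Graph n → SimplicialComplex n
Ind r G .Face       = IsIndependent r G
Ind r G .downClosed = independent-⊆ r G

------------------------------------------------------------------------
-- Rooted trees

module Rooted {T : Graph n} (tree : IsTree T) (root : Fin n) where

  open Membership using () renaming (_∈_ to _∈ˡ_)
  open DecMembership (_≟_ {n}) using () renaming (_∈?_ to _∈ˡ?_)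

  -- The unique path; the one from a vertex to itself is trivial.
  path : Fin n → Fin n → List (Fin n)
  path u w with u ≟ w
  ... | yes _  = u ∷ []
  ... | no u≢w = proj₁ (IsTree.uniquePath tree u w u≢w)

  IsChild : Fin n → Fin n → Set
  IsChild p u = u ≢ root × Adj T u p × p ∈ˡ path u root

  isChild? : Decidable IsChild
  isChild? p u = ¬? (u ≟ root) ×-dec adj? T u p ×-dec p ∈ˡ? path u root

  Ch : Fin n → Subset n
  Ch p = fromDec (isChild? p)

  IsDescendant : Fin n → Fin n → Set
  IsDescendant u w = u ∈ˡ path root w

  isDescendant? : Decidable IsDescendant
  isDescendant? u w = u ∈ˡ? path root w

  -- The vertex set of the rooted subtree at u.
  V[_] : Fin n → Subset n
  V[ u ] = ⁅ u ⁆ ∪ fromDec (isDescendant? u)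

{-# OPTIONS --safe #-}
-- By uniqueness of paths, for a child u of v the set V(T_u) consists of the
-- vertices reachable from u without meeting v.  Hence an edge leaving V(T_u)
-- ends in v, and a connected set avoiding v meets at most one V(T_u).
--
-- If A is as in the statement and D is the union of the V(T_u), u ∈ A, then a
-- facet F of the deletion must contain D, because adding D to F only adds
-- components of size at most r.  So F ∪ {v} contains the connected set D ∪ {v}
-- and is not a face.
--
-- Conversely, let A consist of all children u with |V(T_u)| ≤ r, and suppose
-- that |D ∪ {v}| ≤ r.  For every other child u choose a connected S_u ⊆ V(T_u)
-- with u ∈ S_u and |S_u| = r + 1.  The union of the sets S_u ∖ {u} is a face;
-- a facet F of the deletion containing it contains none of these u, so the
-- component of v in F ∪ {v} lies in D ∪ {v}.  Thus F ∪ {v} is a face, and v is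
-- not a shedding vertex.
module Submission where

open import Defs
open import Data.Bool.Properties using () renaming (_≟_ to _≟ᵇ_)
open import Data.Nat using (ℕ; zero; suc; _+_; _∸_; _≤_; _≥_; _<_; _<?_; _≤?_; s≤s⁻¹)
open import Data.Nat.Properties
  using (≤-reflexive; ≤-trans; <⇒≱; ≰⇒>; ≮⇒≥; <⇒≤; +-comm;
         ∸-monoʳ-<)
open import Data.Nat.Induction using (<-wellFounded)
open import Data.Fin using (Fin; zero; suc; _≟_)
open import Data.Fin.Properties using (any?)
open import Data.Fin.Subset
  using (Subset; _∈_; _∉_; _⊆_; _∪_; _-_; ⋃; ⁅_⁆; ∣_∣; ⊥; inside; outside)
open import Data.Fin.Subset.Properties
  using (_∈?_; ∉⊥; x∈⁅x⁆; x∈⁅y⁆⇒x≡y; ∣⁅x⁆∣≡1; p⊆q⇒∣p∣≤∣q∣; p⊂q⇒∣p∣<∣q∣;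
         ∣p∣≤n; p⊆p∪q; q⊆p∪q; x∈p∪q⁻; x∈p∧x≢y⇒x∈p-y;
         x∈p⇒∣p-x∣<∣p∣; ⊆-antisym; p─q⊆p; ∪-identityʳ)
open import Data.List using ([]; _∷_; allFin; last)
open import Data.List.Membership.Propositional using () renaming (_∈_ to _∈ˡ_; _∉_ to _∉ˡ_)
open import Data.List.Membership.Propositional.Properties
  using (∈-allFin; ∈-map∘filter⁺; ∈-map∘filter⁻)
open import Data.List.Membership.DecPropositional using () renaming (_∈?_ to ∈ˡ?)
open import Data.List.Relation.Binary.Subset.Propositional using () renaming (_⊆_ to _⊆ˡ_)
open import Data.List.Relation.Unary.All using ([]; _∷_)
import Data.List.Relation.Unary.All as All
open import Data.List.Relation.Unary.All.Properties using (¬Any⇒All¬)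
open import Data.List.Relation.Unary.AllPairs using ([]; _∷_)
open import Data.List.Relation.Unary.Any using (here; there)
open import Data.List.Relation.Unary.Linked using ([-]; _∷_)
open import Data.Maybe using (just)
open import Data.Maybe.Properties using (just-injective)
open import Data.Product using (∃; _×_; _,_; proj₁; proj₂)
open import Data.Sum using (_⊎_; inj₁; inj₂; [_,_]′)
open import Data.Vec using (here; there) renaming (_∷_ to _∷ᵛ_)
open import Data.Vec.Properties using (≡-dec)
open import Function using (_⇔_; mk⇔; Equivalence; id; _∘_)
open import Induction.WellFounded using (Acc; acc)
open import Relation.Binary.Construct.Closure.ReflexiveTransitive
  using (Star; ε; _◅_; _◅◅_)
import Relation.Binary.Construct.Closure.ReflexiveTransitive as Star
open import Relation.Binary.PropositionalEquality
  using (_≡_; _≢_; refl; sym; trans; cong; subst)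
open import Relation.Nullary using (Dec; yes; no; ¬_; ¬?; _×-dec_; contradiction)
open import Relation.Nullary.Decidable using (decidable-stable)

private
  variable
    n : ℕ

-- Finite subsets and indexed unions.

∪-least : {p q s : Subset n} → p ⊆ s → q ⊆ s → p ∪ q ⊆ s
∪-least {p = p} {q} p⊆s q⊆s x∈ = [ p⊆s , q⊆s ]′ (x∈p∪q⁻ p q x∈)

⁅x⁆⊆p : ∀ {x} {p : Subset n} → x ∈ p → ⁅ x ⁆ ⊆ p
⁅x⁆⊆p {x = x} {p} x∈p y∈ = subst (_∈ p) (sym (x∈⁅y⁆⇒x≡y x y∈)) x∈p

⊆-or-witness : (p q : Subset n) → p ⊆ q ⊎ ∃ λ x → x ∈ p × x ∉ q
⊆-or-witness p q with any? (λ x → x ∈? p ×-dec ¬? (x ∈? q))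
... | yes x∈p∖q = inj₂ x∈p∖q
... | no ∄ = inj₁ λ {x} x∈p → decidable-stable (x ∈? q) λ x∉q → ∄ (x , x∈p , x∉q)

p⊆q∧p≢q⇒∣p∣<∣q∣ : {p q : Subset n} → p ⊆ q → p ≢ q → ∣ p ∣ < ∣ q ∣
p⊆q∧p≢q⇒∣p∣<∣q∣ {p = p} {q} p⊆q p≢q with ⊆-or-witness q p
... | inj₁ q⊆p = contradiction (⊆-antisym p⊆q q⊆p) p≢q
... | inj₂ x∈q∖p = p⊂q⇒∣p∣<∣q∣ (p⊆q , x∈q∖p)

∣p∣<∣q∣⇒∃∈q∖p : {p q : Subset n} → ∣ p ∣ < ∣ q ∣ → ∃ λ x → x ∈ q × x ∉ p
∣p∣<∣q∣⇒∃∈q∖p {p = p} {q} p<q with ⊆-or-witness q p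
... | inj₁ q⊆p = contradiction (p⊆q⇒∣p∣≤∣q∣ q⊆p) (<⇒≱ p<q)
... | inj₂ x∈q∖p = x∈q∖p

∣p∪⁅x⁆∣≡1+∣p∣ : ∀ {p : Subset n} x → x ∉ p → ∣ p ∪ ⁅ x ⁆ ∣ ≡ suc ∣ p ∣
∣p∪⁅x⁆∣≡1+∣p∣ {p = inside  ∷ᵛ p} zero x∉p = contradiction here x∉p
∣p∪⁅x⁆∣≡1+∣p∣ {p = outside ∷ᵛ p} zero x∉p = cong (suc ∘ ∣_∣) (∪-identityʳ p)
∣p∪⁅x⁆∣≡1+∣p∣ {p = inside  ∷ᵛ p} (suc x) x∉p =
  cong suc (∣p∪⁅x⁆∣≡1+∣p∣ x (x∉p ∘ there))
∣p∪⁅x⁆∣≡1+∣p∣ {p = outside ∷ᵛ p} (suc x) x∉p = ∣p∪⁅x⁆∣≡1+∣p∣ x (x∉p ∘ there)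

∈-⋃⁺ : ∀ {x} {p : Subset n} {ps} → p ∈ˡ ps → x ∈ p → x ∈ ⋃ ps
∈-⋃⁺ {ps = p ∷ ps} (here refl) x∈p = p⊆p∪q (⋃ ps) x∈p
∈-⋃⁺ {ps = q ∷ ps} (there p∈) x∈p = q⊆p∪q q (⋃ ps) (∈-⋃⁺ p∈ x∈p)

∈-⋃⁻ : ∀ {x : Fin n} ps → x ∈ ⋃ ps → ∃ λ p → p ∈ˡ ps × x ∈ p
∈-⋃⁻ [] x∈ = contradiction x∈ ∉⊥
∈-⋃⁻ (p ∷ ps) x∈ with x∈p∪q⁻ p (⋃ ps) x∈
... | inj₁ x∈p = p , here refl , x∈p
... | inj₂ x∈⋃ with ∈-⋃⁻ ps x∈⋃
...   | q , q∈ , x∈q = q , there q∈ , x∈q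

∈-⋃[]⁺ : ∀ {A : Subset n} {S x u} → u ∈ A → x ∈ S u → x ∈ ⋃[ A ] S
∈-⋃[]⁺ {A = A} {S} {u = u} u∈A =
  ∈-⋃⁺ (∈-map∘filter⁺ S (_∈? A) (u , ∈-allFin u , refl , u∈A))

∈-⋃[]⁻ : ∀ {A : Subset n} {S x} → x ∈ ⋃[ A ] S → ∃ λ u → u ∈ A × x ∈ S u
∈-⋃[]⁻ {A = A} {S} {x} x∈ with ∈-⋃⁻ _ x∈
... | p , p∈ , x∈p with ∈-map∘filter⁻ S (_∈? A) {xs = allFin _} p∈
...   | u , _ , p≡Su , u∈A = u , u∈A , subst (x ∈_) p≡Su x∈p

-- Walks in a relation; facets above a face.

Star-resp : ∀ {I : Set} {R : I → I → Set} (P : I → Set) →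
            (∀ {x y} → R x y → P x → P y) → ∀ {x y} → Star R x y → P x → P y
Star-resp P step = Star.fold (λ x y → P x → P y) (λ r k → k ∘ step r) id

crossing : ∀ {I : Set} {R : I → I → Set} {P : I → Set} → (∀ x → Dec (P x)) →
           ∀ {x y} → Star R x y → P x → ¬ P y →
           ∃ λ a → ∃ λ b → R a b × P a × ¬ P b
crossing P? ε Px ¬Py = contradiction Px ¬Py
crossing P? {x} (_◅_ {j = z} r s) Px ¬Py with P? z
... | yes Pz = crossing P? s Pz ¬Py
... | no ¬Pz = x , z , r , Px , ¬Pz

-- Faces of `Δ` are not assumed decidable, hence the double negation, which suffices where a
-- contradiction is sought. If no facet lay above `F`, none would lie above a larger face either;
-- recursion on `n ∸ ∣ F ∣` rules larger faces out, so `F` itself would be a facet.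
¬¬-facet : (Δ : SimplicialComplex n) → ∀ F → Face Δ F →
           ¬ ¬ (∃ λ F′ → F ⊆ F′ × IsFacet Δ F′)
¬¬-facet {n} Δ F = go F (<-wellFounded _)
  where
  go : ∀ F → Acc _<_ (n ∸ ∣ F ∣) → Face Δ F →
       ¬ ¬ (∃ λ F′ → F ⊆ F′ × IsFacet Δ F′)
  go F (acc rec) face ∄ = ∄ (F , id , face , maximal)
    where
    maximal : ∀ F′ → Face Δ F′ → F ⊆ F′ → F ≡ F′
    maximal F′ face′ F⊆F′ = decidable-stable (≡-dec _≟ᵇ_ F F′) λ F≢F′ →
      go F′ (rec (∸-monoʳ-< (p⊆q∧p≢q⇒∣p∣<∣q∣ F⊆F′ F≢F′) (∣p∣≤n F′)))
         face′ λ (F″ , F′⊆F″ , facet) → ∄ (F″ , F′⊆F″ ∘ F⊆F′ , facet)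

-- Connected vertex sets and independence.

module _ (G : Graph n) where

  AdjIn-mono : ∀ {X Y x y} → X ⊆ Y → AdjIn G X x y → AdjIn G Y x y
  AdjIn-mono X⊆Y (x∈ , y∈ , xy) = X⊆Y x∈ , X⊆Y y∈ , xy

  AdjIn-sym : ∀ {X x y} → AdjIn G X x y → AdjIn G X y x
  AdjIn-sym (x∈ , y∈ , xy) = y∈ , x∈ , symm G xy

  -- Unlike a component, such a set need not be maximal in an ambient set, so size bounds carry over
  -- from one ambient set to another.
  ConnectedFrom : Fin n → Subset n → Set
  ConnectedFrom x X = x ∈ X × (∀ {y} → y ∈ X → Star (AdjIn G X) x y)

  connected-rebase : ∀ {x y X} → ConnectedFrom x X → y ∈ X → ConnectedFrom y X
  connected-rebase (x∈ , reach) y∈ =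
    y∈ , λ z∈ → Star.reverse AdjIn-sym (reach y∈) ◅◅ reach z∈

  connected-⊆ : ∀ {x X P} → ConnectedFrom x X → x ∈ P →
                (∀ {y z} → z ∈ X → Adj G y z → y ∈ P → z ∈ P) → X ⊆ P
  connected-⊆ {P = P} (_ , reach) x∈P closed y∈X =
    Star-resp (_∈ P) (λ (_ , z∈ , yz) → closed z∈ yz) (reach y∈X) x∈P

  -- `X` is a component of its own induced subgraph, and independence passes from `F` down to `X`.
  independent⇒∣connected∣≤ : ∀ {r F X x} → IsIndependent r G F →
                             ConnectedFrom x X → X ⊆ F → ∣ X ∣ ≤ r
  independent⇒∣connected∣≤ {r} {X = X} {x} indep (x∈ , reach) X⊆F =
    independent-⊆ r G X⊆F indep X (x , x∈ , λ y → mk⇔ reach (λ s →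
      Star-resp (_∈ X) (λ (_ , z∈ , _) _ → z∈) s x∈))

  component⇒connected : ∀ {A C} → IsComponent G A C →
                        C ⊆ A × ∃ λ x → ConnectedFrom x C
  component⇒connected {A} {C} (x , x∈A , C⇔) = C⊆A , x , from ε , within ε ∘ to
    where
    to : ∀ {y} → y ∈ C → Star (AdjIn G A) x y
    to = Equivalence.to (C⇔ _)

    from : ∀ {y} → Star (AdjIn G A) x y → y ∈ C
    from = Equivalence.from (C⇔ _)

    C⊆A : C ⊆ A
    C⊆A y∈C = Star-resp (_∈ A) (λ (_ , z∈ , _) _ → z∈) (to y∈C) x∈A

    -- Every vertex on a walk continuing from `x` is again reachable from `x`, so the walk stays in
    -- `C`.
    within : ∀ {y z} → Star (AdjIn G A) x y → Star (AdjIn G A) y z →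
             Star (AdjIn G C) y z
    within xy ε = ε
    within xy (e ◅ s) = (from xy , from xy′ , proj₂ (proj₂ e)) ◅ within xy′ s
      where xy′ = xy ◅◅ e ◅ ε

  ∣connected∣≤⇒independent : ∀ {r F} →
    (∀ {X x} → ConnectedFrom x X → X ⊆ F → ∣ X ∣ ≤ r) → IsIndependent r G F
  ∣connected∣≤⇒independent bound C comp with component⇒connected comp
  ... | C⊆F , _ , conn = bound conn C⊆F

  connected-∪⁅⁆ : ∀ {x X y z} → ConnectedFrom x X → y ∈ X → Adj G y z →
                  ConnectedFrom x (X ∪ ⁅ z ⁆)
  connected-∪⁅⁆ {x} {X} {y} {z} (x∈ , reach) y∈ yz = left x∈ , reach′
    where
    left : X ⊆ X ∪ ⁅ z ⁆
    left = p⊆p∪q ⁅ z ⁆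

    right : z ∈ X ∪ ⁅ z ⁆
    right = q⊆p∪q X ⁅ z ⁆ (x∈⁅x⁆ z)

    reach′ : ∀ {w} → w ∈ X ∪ ⁅ z ⁆ → Star (AdjIn G (X ∪ ⁅ z ⁆)) x w
    reach′ w∈ with x∈p∪q⁻ X ⁅ z ⁆ w∈
    ... | inj₁ w∈X = Star.map (AdjIn-mono left) (reach w∈X)
    ... | inj₂ w∈z with refl ← x∈⁅y⁆⇒x≡y z w∈z =
      Star.map (AdjIn-mono left) (reach y∈) ◅◅ (left y∈ , right , yz) ◅ ε

  -- Grow from `⁅ x ⁆` one vertex at a time: a walk in `C` from `x` to a vertex outside `S` crosses
  -- out of `S` somewhere, and the far end of the crossing edge can be added.
  connected-subset : ∀ {x C} → ConnectedFrom x C → ∀ k → suc k ≤ ∣ C ∣ →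
    ∃ λ S → S ⊆ C × ConnectedFrom x S × ∣ S ∣ ≡ suc k
  connected-subset {x} {C} (x∈C , _) zero _ =
    ⁅ x ⁆ , ⁅x⁆⊆p x∈C ,
    (x∈⁅x⁆ x , λ {y} y∈ → subst (Star _ x) (sym (x∈⁅y⁆⇒x≡y x y∈)) ε) ,
    ∣⁅x⁆∣≡1 x
  connected-subset {x} {C} conn@(_ , reach) (suc k) k<∣C∣
    with connected-subset conn k (<⇒≤ k<∣C∣)
  ... | S , S⊆C , connS , ∣S∣≡
    with ∣p∣<∣q∣⇒∃∈q∖p (subst (_< ∣ C ∣) (sym ∣S∣≡) k<∣C∣)
  ...   | y , y∈C , y∉S
    with crossing (_∈? S) (reach y∈C) (proj₁ connS) y∉S
  ...     | a , b , (_ , b∈C , ab) , a∈S , b∉S =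
    S ∪ ⁅ b ⁆ , ∪-least S⊆C (⁅x⁆⊆p b∈C) , connected-∪⁅⁆ connS a∈S ab ,
    trans (∣p∪⁅x⁆∣≡1+∣p∣ b b∉S) (cong suc ∣S∣≡)

  -- Paths, and walks avoiding a vertex.

  IsPath-cons : ∀ {x u w xs} → Adj G x u → x ∉ˡ xs → IsPath G u w xs →
                IsPath G x w (x ∷ xs)
  IsPath-cons {xs = []} _ _ record { starts = () }
  IsPath-cons {xs = y ∷ ys} xu x∉
    record { starts = refl ; ends = ends ; linked = linked ; distinct = distinct } =
    record { starts = refl ; ends = ends ; linked = xu ∷ linked
           ; distinct = ¬Any⇒All¬ (y ∷ ys) x∉ ∷ distinct }

  IsPath-suffix : ∀ {u w z xs} → IsPath G u w xs → z ∈ˡ xs →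
                  ∃ λ ys → IsPath G z w ys × ys ⊆ˡ xs
  IsPath-suffix {xs = x ∷ xs} p (here refl) =
    x ∷ xs , record { IsPath p ; starts = refl } , id
  IsPath-suffix {xs = x ∷ y ∷ xs}
    record { ends = ends ; linked = _ ∷ linked ; distinct = _ ∷ distinct } (there z∈)
    with IsPath-suffix
           record { starts = refl ; ends = ends ; linked = linked ; distinct = distinct } z∈
  ... | ys , q , ys⊆ = ys , q , there ∘ ys⊆

  end∈path : ∀ {u w xs} → IsPath G u w xs → w ∈ˡ xs
  end∈path p = last∈ _ (IsPath.ends p)
    where
    last∈ : ∀ {w : Fin n} xs → last xs ≡ just w → w ∈ˡ xs
    last∈ (x ∷ []) refl = here refl
    last∈ (x ∷ y ∷ xs) eq = there (last∈ (y ∷ xs) eq)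

  start∈path : ∀ {u w xs} → IsPath G u w xs → u ∈ˡ xs
  start∈path {xs = x ∷ xs} record { starts = refl } = here refl

  -- Only the target of a step is constrained; that the start of a walk differs from `v` is a
  -- separate hypothesis where needed.
  StepAvoiding : Fin n → Fin n → Fin n → Set
  StepAvoiding v x y = Adj G x y × y ≢ v

  path⇒walk : ∀ {v u w} xs → IsPath G u w xs → v ∉ˡ xs → Star (StepAvoiding v) u w
  path⇒walk [] record { starts = () } _
  path⇒walk (u ∷ []) record { starts = refl ; ends = refl } _ = ε
  path⇒walk (u ∷ x ∷ xs)
    record { starts = refl ; ends = ends ; linked = ux ∷ linked ; distinct = _ ∷ distinct } v∉ =
    (ux , λ { refl → v∉ (there (here refl)) }) ◅
    path⇒walk (x ∷ xs)
      record { starts = refl ; ends = ends ; linked = linked ; distinct = distinct }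
      (v∉ ∘ there)

  -- Loop erasure from the far end: `u` is prepended to the path already built, unless it lies on
  -- that path, in which case the suffix from `u` is taken.
  walk⇒path : ∀ {v u w} → u ≢ v → Star (StepAvoiding v) u w →
              ∃ λ xs → IsPath G u w xs × v ∉ˡ xs
  walk⇒path {u = u} u≢v ε =
    u ∷ [] ,
    record { starts = refl ; ends = refl ; linked = [-] ; distinct = [] ∷ [] } ,
    λ { (here refl) → u≢v refl }
  walk⇒path {u = u} u≢v ((ux , x≢v) ◅ s) with walk⇒path x≢v s
  ... | xs , p , v∉ with ∈ˡ? _≟_ u xs
  ...   | no u∉ = u ∷ xs , IsPath-cons ux u∉ p ,
                  λ { (here refl) → u≢v refl ; (there v∈) → v∉ v∈ }
  ...   | yes u∈ with IsPath-suffix p u∈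
  ...     | ys , q , ys⊆ = ys , q , v∉ ∘ ys⊆

-- The subtrees at the children of the root.

module Subtrees {T : Graph n} (tree : IsTree T) (v : Fin n) where

  open Rooted tree v

  Walk : Fin n → Fin n → Set
  Walk = Star (StepAvoiding T v)

  path-isPath : ∀ {u w} → u ≢ w → IsPath T u w (path u w)
  path-isPath {u} {w} u≢w with u ≟ w
  ... | yes u≡w = contradiction u≡w u≢w
  ... | no u≢w′ = proj₁ (proj₂ (IsTree.uniquePath tree u w u≢w′))

  path-unique : ∀ {u w xs} → u ≢ w → IsPath T u w xs → path u w ≡ xs
  path-unique {u} {w} u≢w p with u ≟ w
  ... | yes u≡w = contradiction u≡w u≢w
  ... | no u≢w′ = proj₂ (proj₂ (IsTree.uniquePath tree u w u≢w′)) p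

  ∈path-trivial : ∀ {x u} → x ∈ˡ path u u → x ≡ u
  ∈path-trivial {u = u} x∈ with u ≟ u
  ∈path-trivial (here x≡u) | yes _ = x≡u
  ∈path-trivial _ | no u≢u = contradiction refl u≢u

  child⁺ : ∀ {u} → Adj T u v → u ∈ Ch v
  child⁺ {u} uv = Equivalence.from (∈-fromDec (isChild? v))
    (u≢v , uv , end∈path T (path-isPath u≢v))
    where
    u≢v : u ≢ v
    u≢v u≡v = irrefl T u≡v uv

  child⇒≢root : ∀ {u} → u ∈ Ch v → u ≢ v
  child⇒≢root = proj₁ ∘ Equivalence.to (∈-fromDec (isChild? v))

  child⇒adj : ∀ {u} → u ∈ Ch v → Adj T u v
  child⇒adj = proj₁ ∘ proj₂ ∘ Equivalence.to (∈-fromDec (isChild? v))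

  -- Loop erasure gives a path from `u` that avoids `v`; with `v` prepended it is a path from the
  -- root, hence the unique one.
  root∷path : ∀ {u w} → u ∈ Ch v → Walk u w →
              ∃ λ xs → path v w ≡ v ∷ xs × IsPath T u w xs
  root∷path u∈ s with walk⇒path T (child⇒≢root u∈) s
  ... | xs , p , v∉ =
    xs , path-unique (λ { refl → v∉ (end∈path T p) })
                     (IsPath-cons T (symm T (child⇒adj u∈)) v∉ p) , p

  walk⇒∈V : ∀ {u w} → u ∈ Ch v → Walk u w → w ∈ V[ u ]
  walk⇒∈V {u} u∈ s with root∷path u∈ s
  ... | xs , eq , p = q⊆p∪q ⁅ u ⁆ _ (Equivalence.from (∈-fromDec (isDescendant? u))
    (subst (u ∈ˡ_) (sym eq) (there (start∈path T p))))

  -- The path from `v` repeats no vertex, so `v` occurs only at its head and the suffix from `u`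
  -- avoids it.
  descendant⇒walk : ∀ {u w} → u ≢ v → IsDescendant u w → Walk u w
  descendant⇒walk {u} {w} u≢v u∈ = go (path v w) (path-isPath v≢w) u∈
    where
    v≢w : v ≢ w
    -- `path v v` is the one-vertex list, so `w` equal to `v` would force `u` to be `v`.
    v≢w refl = u≢v (∈path-trivial u∈)

    go : ∀ xs → IsPath T v w xs → u ∈ˡ xs → Walk u w
    go (x ∷ xs) record { starts = refl } (here refl) = contradiction refl u≢v
    go (x ∷ y ∷ xs)
      record { starts = refl ; ends = ends ; linked = _ ∷ linked ; distinct = v≢ ∷ distinct }
      (there u∈′)
      with IsPath-suffix T
             record { starts = refl ; ends = ends ; linked = linked ; distinct = distinct } u∈′
    ... | ys , q , ys⊆ = path⇒walk T ys q λ v∈ → All.lookup v≢ (ys⊆ v∈) refl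

  ∈V⇒walk : ∀ {u w} → u ∈ Ch v → w ∈ V[ u ] → Walk u w
  ∈V⇒walk {u} u∈ w∈ with x∈p∪q⁻ ⁅ u ⁆ _ w∈
  ... | inj₁ w∈u with refl ← x∈⁅y⁆⇒x≡y u w∈u = ε
  ... | inj₂ desc = descendant⇒walk (child⇒≢root u∈)
                      (Equivalence.to (∈-fromDec (isDescendant? u)) desc)

  u∈V[u] : ∀ {u} → u ∈ V[ u ]
  u∈V[u] {u} = p⊆p∪q _ (x∈⁅x⁆ u)

  V-closed : ∀ {u y z} → u ∈ Ch v → y ∈ V[ u ] → Adj T y z → z ≢ v → z ∈ V[ u ]
  V-closed u∈ y∈ yz z≢v = walk⇒∈V u∈ (∈V⇒walk u∈ y∈ ◅◅ (yz , z≢v) ◅ ε)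

  root∉V : ∀ {u} → u ∈ Ch v → v ∉ V[ u ]
  root∉V u∈ v∈ =
    Star-resp (_≢ v) (λ (_ , y≢v) _ → y≢v) (∈V⇒walk u∈ v∈) (child⇒≢root u∈) refl

  -- The second vertex of the path from the root to `w` is both `u` and `u′`.
  V-disjoint : ∀ {u u′ w} → u ∈ Ch v → u′ ∈ Ch v → w ∈ V[ u ] → w ∈ V[ u′ ] → u ≡ u′
  V-disjoint u∈ u′∈ w∈ w∈′
    with root∷path u∈ (∈V⇒walk u∈ w∈) | root∷path u′∈ (∈V⇒walk u′∈ w∈′)
  ... | xs , eq , p | xs′ , eq′ , p′ with refl ← trans (sym eq) eq′ =
    just-injective (trans (sym (IsPath.starts p)) (IsPath.starts p′))

  V-connected : ∀ {u} → u ∈ Ch v → ConnectedFrom T u V[ u ]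
  V-connected {u} u∈ = u∈V[u] , λ w∈ → lift u∈V[u] (∈V⇒walk u∈ w∈)
    where
    lift : ∀ {x y} → x ∈ V[ u ] → Walk x y → Star (AdjIn T V[ u ]) x y
    lift _ ε = ε
    lift x∈ ((xz , z≢v) ◅ s) = (x∈ , z∈ , xz) ◅ lift z∈ s
      where z∈ = V-closed u∈ x∈ xz z≢v

  connected⊆V : ∀ {u x X} → u ∈ Ch v → ConnectedFrom T x X → v ∉ X →
                x ∈ V[ u ] → X ⊆ V[ u ]
  connected⊆V u∈ conn v∉X x∈ = connected-⊆ T conn x∈ λ z∈X yz y∈ →
    V-closed u∈ y∈ yz λ { refl → v∉X z∈X }

  ⋃V∪root-connected : ∀ {A} → A ⊆ Ch v → ConnectedFrom T v (⋃[ A ] V[_] ∪ ⁅ v ⁆)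
  ⋃V∪root-connected {A} A⊆Ch = v∈ , reach
    where
    D = ⋃[ A ] V[_]

    v∈ : v ∈ D ∪ ⁅ v ⁆
    v∈ = q⊆p∪q D ⁅ v ⁆ (x∈⁅x⁆ v)

    reach : ∀ {y} → y ∈ D ∪ ⁅ v ⁆ → Star (AdjIn T (D ∪ ⁅ v ⁆)) v y
    reach y∈ with x∈p∪q⁻ D ⁅ v ⁆ y∈
    ... | inj₂ y∈v with refl ← x∈⁅y⁆⇒x≡y v y∈v = ε
    ... | inj₁ y∈D with ∈-⋃[]⁻ y∈D
    ...   | u , u∈A , y∈V =
      (v∈ , Vu⊆ u∈V[u] , symm T (child⇒adj (A⊆Ch u∈A))) ◅
      Star.map (AdjIn-mono T Vu⊆) (proj₂ (V-connected (A⊆Ch u∈A)) y∈V)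
      where
      Vu⊆ : V[ u ] ⊆ D ∪ ⁅ v ⁆
      Vu⊆ = p⊆p∪q ⁅ v ⁆ ∘ ∈-⋃[]⁺ u∈A

  -- Sufficiency: small subtrees with a large union.

  module _ {r : ℕ} where

    root∉⋃V : ∀ {A} → A ⊆ Ch v → v ∉ ⋃[ A ] V[_]
    root∉⋃V A⊆Ch v∈ with ∈-⋃[]⁻ v∈
    ... | u , u∈A , v∈V = root∉V (A⊆Ch u∈A) v∈V

    -- A connected set avoiding `v` that starts in some `V[ u ]` stays there. One that starts
    -- outside `D` never meets `D`, since rebasing it at a common vertex would put its start into
    -- `D`; so it lies in `F`.
    ∪⋃V-face : ∀ {A F} → A ⊆ Ch v → (∀ u → u ∈ A → ∣ V[ u ] ∣ ≤ r) →
               Face (del (Ind r T) v) F → Face (del (Ind r T) v) (F ∪ ⋃[ A ] V[_])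
    ∪⋃V-face {A} {F} A⊆Ch small (indep , v∉F) =
      ∣connected∣≤⇒independent T bound , v∉
      where
      D = ⋃[ A ] V[_]

      v∉ : v ∉ F ∪ D
      v∉ v∈ = [ v∉F , root∉⋃V A⊆Ch ]′ (x∈p∪q⁻ F D v∈)

      bound : ∀ {X x} → ConnectedFrom T x X → X ⊆ F ∪ D → ∣ X ∣ ≤ r
      bound {X} {x} conn@(x∈X , _) X⊆ with x ∈? D
      ... | yes x∈D with ∈-⋃[]⁻ x∈D
      ...   | u , u∈A , x∈V =
        ≤-trans (p⊆q⇒∣p∣≤∣q∣ (connected⊆V (A⊆Ch u∈A) conn (v∉ ∘ X⊆) x∈V)) (small u u∈A)
      bound {X} {x} conn@(x∈X , _) X⊆ | no x∉D =
        independent⇒∣connected∣≤ T indep conn X⊆F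
        where
        disjoint : ∀ {y} → y ∈ X → y ∉ D
        disjoint y∈X y∈D with ∈-⋃[]⁻ y∈D
        ... | u , u∈A , y∈V = x∉D (∈-⋃[]⁺ u∈A
          (connected⊆V (A⊆Ch u∈A) (connected-rebase T conn y∈X) (v∉ ∘ X⊆) y∈V x∈X))

        X⊆F : X ⊆ F
        X⊆F y∈X with x∈p∪q⁻ F D (X⊆ y∈X)
        ... | inj₁ y∈F = y∈F
        ... | inj₂ y∈D = contradiction y∈D (disjoint y∈X)

    large⋃V⇒shedding : 1 ≤ r → ∀ {A} → A ⊆ Ch v → (∀ u → u ∈ A → ∣ V[ u ] ∣ ≤ r) →
                       r < ∣ ⋃[ A ] V[_] ∪ ⁅ v ⁆ ∣ → IsSheddingVertex (Ind r T) v
    large⋃V⇒shedding 1≤r {A} A⊆Ch small large = record { vertex = vertex ; shed = shed }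
      where
      D = ⋃[ A ] V[_]

      vertex : IsIndependent r T ⁅ v ⁆
      vertex = ∣connected∣≤⇒independent T λ _ X⊆v →
        ≤-trans (p⊆q⇒∣p∣≤∣q∣ X⊆v) (≤-trans (≤-reflexive (∣⁅x⁆∣≡1 v)) 1≤r)

      shed : ∀ F → IsFacet (del (Ind r T) v) F → IsFacet (Ind r T) F
      shed F (face , maximal) = proj₁ face , maximal′
        where
        D⊆F : D ⊆ F
        D⊆F = subst (D ⊆_)
          (sym (maximal (F ∪ D) (∪⋃V-face A⊆Ch small face) (p⊆p∪q D))) (q⊆p∪q F D)

        -- `F` is known to be maximal only among faces avoiding `v`, so it remains to exclude `v`
        -- from `F′`.
        maximal′ : ∀ F′ → IsIndependent r T F′ → F ⊆ F′ → F ≡ F′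
        maximal′ F′ indep F⊆F′ = maximal F′ (indep , v∉F′) F⊆F′
          where
          v∉F′ : v ∉ F′
          v∉F′ v∈F′ = <⇒≱ large
            (independent⇒∣connected∣≤ T indep (⋃V∪root-connected A⊆Ch)
              (∪-least (F⊆F′ ∘ D⊆F) (⁅x⁆⊆p v∈F′)))

    -- Necessity: blocking the large children.

    Large? : ∀ u → Dec (u ∈ Ch v × r < ∣ V[ u ] ∣)
    Large? u = u ∈? Ch v ×-dec r <? ∣ V[ u ] ∣

    Small? : ∀ u → Dec (u ∈ Ch v × ∣ V[ u ] ∣ ≤ r)
    Small? u = u ∈? Ch v ×-dec ∣ V[ u ] ∣ ≤? r

    large small : Subset n
    large = fromDec Large?
    small = fromDec Small?

    -- `K` stands for the chosen connected set with `u` removed: small enough to be independent, yet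
    -- any face containing it must omit `u`.
    Blocks : Subset n → Fin n → Set
    Blocks K u = K ⊆ V[ u ] × ∣ K ∣ ≤ r × ¬ IsIndependent r T (K ∪ ⁅ u ⁆)

    blocker : ∀ u → ∃ λ K → u ∈ large → Blocks K u
    blocker u with Large? u
    -- The union below takes a function on all vertices; the empty set is a dummy value off `large`.
    ... | no ¬large = ⊥ , λ u∈ → contradiction (Equivalence.to (∈-fromDec Large?) u∈) ¬large
    -- `S` has `r + 1` vertices: removing `u` brings it down to the bound, restoring `u` exceeds it.
    ... | yes (u∈Ch , r<) with connected-subset T (V-connected u∈Ch) r r<
    ...   | S , S⊆V , conn@(u∈S , _) , ∣S∣≡ = S - u , λ _ →
      S⊆V ∘ p─q⊆p S ⁅ u ⁆ ,
      s≤s⁻¹ (subst (∣ S - u ∣ <_) ∣S∣≡ (x∈p⇒∣p-x∣<∣p∣ u∈S)) ,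
      λ indep → <⇒≱ (≤-reflexive (sym ∣S∣≡)) (independent⇒∣connected∣≤ T indep conn S⊆)
      where
      S⊆ : S ⊆ (S - u) ∪ ⁅ u ⁆
      S⊆ {x} x∈S with x ≟ u
      ... | yes refl = q⊆p∪q (S - u) ⁅ u ⁆ (x∈⁅x⁆ u)
      ... | no x≢u = p⊆p∪q ⁅ u ⁆ (x∈p∧x≢y⇒x∈p-y x∈S x≢u)

    K : Fin n → Subset n
    K = proj₁ ∘ blocker

    K-blocks : ∀ {u} → u ∈ large → Blocks (K u) u
    K-blocks {u} = proj₂ (blocker u)

    large⊆Ch : large ⊆ Ch v
    large⊆Ch = proj₁ ∘ Equivalence.to (∈-fromDec Large?)

    small⊆Ch : small ⊆ Ch v
    small⊆Ch = proj₁ ∘ Equivalence.to (∈-fromDec Small?)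

    -- A connected subset stays in one `V[ u ]`; as the subtrees are disjoint, it then lies in `K u`
    -- alone.
    ⋃K-face : Face (del (Ind r T) v) (⋃[ large ] K)
    ⋃K-face = ∣connected∣≤⇒independent T bound , v∉
      where
      v∉ : v ∉ ⋃[ large ] K
      v∉ v∈ with ∈-⋃[]⁻ v∈
      ... | u , u∈ , v∈K = root∉V (large⊆Ch u∈) (proj₁ (K-blocks u∈) v∈K)

      bound : ∀ {X x} → ConnectedFrom T x X → X ⊆ ⋃[ large ] K → ∣ X ∣ ≤ r
      bound {X} conn@(x∈X , _) X⊆ with ∈-⋃[]⁻ (X⊆ x∈X)
      ... | u , u∈ , x∈K with K-blocks u∈
      ...   | K⊆V , ∣K∣≤r , _ = ≤-trans (p⊆q⇒∣p∣≤∣q∣ X⊆K) ∣K∣≤r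
        where
        X⊆V : X ⊆ V[ u ]
        X⊆V = connected⊆V (large⊆Ch u∈) conn (v∉ ∘ X⊆) (K⊆V x∈K)

        X⊆K : X ⊆ K u
        X⊆K {y} y∈X with ∈-⋃[]⁻ (X⊆ y∈X)
        ... | u′ , u′∈ , y∈K = subst (λ u″ → y ∈ K u″)
          (V-disjoint (large⊆Ch u′∈) (large⊆Ch u∈) (proj₁ (K-blocks u′∈) y∈K) (X⊆V y∈X)) y∈K

    -- Only connected sets through `v` are new. A neighbour of `v` in `F` is a small child, as `F`
    -- contains the blocker of every large one. Other edges from a small subtree stay inside it or
    -- return to `v`, so such a set cannot leave `D ∪ ⁅ v ⁆`.
    ∪root-face : ∣ ⋃[ small ] V[_] ∪ ⁅ v ⁆ ∣ ≤ r → ∀ {F} → IsIndependent r T F →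
                 ⋃[ large ] K ⊆ F → IsIndependent r T (F ∪ ⁅ v ⁆)
    ∪root-face D≤r {F} indep ⋃K⊆F = ∣connected∣≤⇒independent T bound
      where
      D = ⋃[ small ] V[_]

      large∉F : ∀ {u} → u ∈ large → u ∉ F
      large∉F u∈ u∈F = proj₂ (proj₂ (K-blocks u∈))
        (independent-⊆ r T (∪-least (⋃K⊆F ∘ ∈-⋃[]⁺ u∈) (⁅x⁆⊆p u∈F)) indep)

      neighbour∈small : ∀ {u} → Adj T v u → u ∈ F → u ∈ small
      neighbour∈small vu u∈F = Equivalence.from (∈-fromDec Small?)
        (u∈Ch , ≮⇒≥ λ r< → large∉F (Equivalence.from (∈-fromDec Large?) (u∈Ch , r<)) u∈F)
        where u∈Ch = child⁺ (symm T vu)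

      bound : ∀ {X x} → ConnectedFrom T x X → X ⊆ F ∪ ⁅ v ⁆ → ∣ X ∣ ≤ r
      bound {X} conn X⊆ with v ∈? X
      ... | no v∉X = independent⇒∣connected∣≤ T indep conn X⊆F
        where
        X⊆F : X ⊆ F
        X⊆F y∈X with x∈p∪q⁻ F ⁅ v ⁆ (X⊆ y∈X)
        ... | inj₁ y∈F = y∈F
        ... | inj₂ y∈v with refl ← x∈⁅y⁆⇒x≡y v y∈v = contradiction y∈X v∉X
      ... | yes v∈X = ≤-trans (p⊆q⇒∣p∣≤∣q∣ X⊆D∪v) D≤r
        where
        v∈D∪v : v ∈ D ∪ ⁅ v ⁆
        v∈D∪v = q⊆p∪q D ⁅ v ⁆ (x∈⁅x⁆ v)

        closed : ∀ {y z} → z ∈ X → Adj T y z → y ∈ D ∪ ⁅ v ⁆ → z ∈ D ∪ ⁅ v ⁆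
        closed {y} {z} z∈X yz y∈ with x∈p∪q⁻ F ⁅ v ⁆ (X⊆ z∈X)
        ... | inj₂ z∈v = q⊆p∪q D ⁅ v ⁆ z∈v
        ... | inj₁ z∈F with z ≟ v
        ...   | yes refl = v∈D∪v
        ...   | no z≢v with x∈p∪q⁻ D ⁅ v ⁆ y∈
        ...     | inj₂ y∈v with refl ← x∈⁅y⁆⇒x≡y v y∈v =
          p⊆p∪q ⁅ v ⁆ (∈-⋃[]⁺ (neighbour∈small yz z∈F) u∈V[u])
        ...     | inj₁ y∈D with ∈-⋃[]⁻ y∈D
        ...       | u , u∈ , y∈V =
          p⊆p∪q ⁅ v ⁆ (∈-⋃[]⁺ u∈ (V-closed (small⊆Ch u∈) y∈V yz z≢v))

        X⊆D∪v : X ⊆ D ∪ ⁅ v ⁆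
        X⊆D∪v = connected-⊆ T (connected-rebase T conn v∈X) v∈D∪v closed

    -- The inequality is decidable, so it may be proved by contradiction, where a double-negated
    -- facet `F` is enough. Shedding makes `F` maximal, against the face `F ∪ ⁅ v ⁆`.
    shedding⇒large⋃V : IsSheddingVertex (Ind r T) v → r < ∣ ⋃[ small ] V[_] ∪ ⁅ v ⁆ ∣
    shedding⇒large⋃V shedding = ≰⇒> λ D≤r →
      ¬¬-facet (del (Ind r T) v) (⋃[ large ] K) ⋃K-face
        λ (F , ⋃K⊆F , facet@((indep , v∉F) , _)) →
          v∉F (subst (v ∈_)
            (sym (proj₂ (IsSheddingVertex.shed shedding F facet) (F ∪ ⁅ v ⁆)
              (∪root-face D≤r indep ⋃K⊆F) (p⊆p∪q ⁅ v ⁆)))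
            (q⊆p∪q F ⁅ v ⁆ (x∈⁅x⁆ v)))

lemma3p1 : ∀ {n} (r : ℕ) → r ≥ 1 →
    (T : Graph n) (tree : IsTree T) → n ≥ r + 1 → (v : Fin n) →
    let open Rooted tree v in
    IsSheddingVertex (Ind r T) v ⇔
    (∃ λ (A : Subset n) →
    A ⊆ Ch v ×
    (∀ u → u ∈ A → ∣ V[ u ] ∣ ≤ r) ×
    ∣ ⋃[ A ] V[_] ∪ ⁅ v ⁆ ∣ ≥ r + 1)
lemma3p1 r 1≤r T tree _ v = mk⇔
  -- The witness is the largest admissible one, all children with subtrees of at most `r` vertices.
  (λ shedding → small , (λ {_} → small⊆Ch) ,
    (λ _ → proj₂ ∘ Equivalence.to (∈-fromDec Small?)) ,
    ≤-trans (≤-reflexive (+-comm r 1)) (shedding⇒large⋃V shedding))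
  (λ (_ , A⊆Ch , bounded , large) →
    large⋃V⇒shedding 1≤r A⊆Ch bounded (≤-trans (≤-reflexive (+-comm 1 r)) large))
  where open Subtrees tree v
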